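{- Let $k\ge1$ be an integer. Every $k$-$\gamma_c$-critical $K_{1,3}$-free graph of even order with minimum degree $\delta\geq 3$ is bi-critical if and only if $k\in\{1,2\}$.
   Context: A connected dominating set of $G$ is a set $D\subseteq V(G)$ such that every vertex is in $D$ or adjacent to a vertex of $D$ and $G[D]$ is connected; $\gamma_c(G)$ is its minimum size. $G$ is $k$-$\gamma_c$-critical if $\gamma_c(G)=k$ and $\gamma_c(G+uv)<k$ for every pair of non-adjacent vertices $u,v$. $G$ is $K_{1,3}$-free if it has no induced subgraph isomorphic to $K_{1,3}$. $G$ is bi-critical if $G-S$ has a perfect matching for every set $S$ of two vertices. -}

module Defs where

open import Data.Nat using (ℕ; _<_; _≤_)
open import Data.Bool using (Bool; true; false; _∨_; _∧_)
open import Data.Fin using (Fin)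
open import Data.Fin.Properties using (_≟_)
open import Data.Fin.Subset using (Subset; _∈_; _∉_; ∣_∣; Nonempty)
open import Data.Vec using (tabulate)
open import Data.Product using (Σ; _×_; ∃; ∃-syntax; _,_)
open import Relation.Nullary using (¬_)
open import Relation.Nullary.Decidable using (⌊_⌋)
open import Relation.Binary.PropositionalEquality using (_≡_; _≢_)

Adj : ℕ → Set
Adj n = Fin n → Fin n → Bool

record Graph (n : ℕ) : Set where
  field
    adj    : Adj n
    sym    : ∀ x y → adj x y ≡ adj y x
    irrefl : ∀ x → adj x x ≡ false
open Graph public

addEdge : ∀ {n} → Adj n → Fin n → Fin n → Adj n
addEdge a u v x y =
  a x y ∨ (⌊ x ≟ u ⌋ ∧ ⌊ y ≟ v ⌋) ∨ (⌊ x ≟ v ⌋ ∧ ⌊ y ≟ u ⌋)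

data WalkIn {n} (a : Adj n) (D : Subset n) : Fin n → Fin n → Set where
  here : ∀ {u} → WalkIn a D u u
  step : ∀ {u v w} → a u v ≡ true → v ∈ D → WalkIn a D v w → WalkIn a D u w

Dominating : ∀ {n} → Adj n → Subset n → Set
Dominating {n} a D = ∀ (x : Fin n) → x ∈ D ⊎' (∃[ y ] (y ∈ D × a x y ≡ true))
  where
  open import Data.Sum using () renaming (_⊎_ to _⊎'_)

-- G[D] is connected (the null graph is not considered connected).
InducedConnected : ∀ {n} → Adj n → Subset n → Set
InducedConnected a D = Nonempty D × (∀ x y → x ∈ D → y ∈ D → WalkIn a D x y)

IsCDS : ∀ {n} → Adj n → Subset n → Set
IsCDS a D = Dominating a D × InducedConnected a D

γc< : ∀ {n} → Adj n → ℕ → Set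
γc< {n} a k = Σ (Subset n) λ D → IsCDS a D × ∣ D ∣ < k

γc≡ : ∀ {n} → Adj n → ℕ → Set
γc≡ {n} a k = (Σ (Subset n) λ D → IsCDS a D × ∣ D ∣ ≡ k) × ¬ γc< a k

Critical : ∀ {n} → Graph n → ℕ → Set
Critical G k = γc≡ (adj G) k ×
  (∀ u v → u ≢ v → adj G u v ≡ false → γc< (addEdge (adj G) u v) k)

ClawFree : ∀ {n} → Graph n → Set
ClawFree {n} G = ¬ (Σ (Fin n) λ c → Σ (Fin n) λ x → Σ (Fin n) λ y → Σ (Fin n) λ z →
  x ≢ y × x ≢ z × y ≢ z ×
  adj G c x ≡ true × adj G c y ≡ true × adj G c z ≡ true ×
  adj G x y ≡ false × adj G x z ≡ false × adj G y z ≡ false)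

degree : ∀ {n} → Graph n → Fin n → ℕ
degree G v = ∣ tabulate (adj G v) ∣

MinDegreeAtLeast : ∀ {n} → Graph n → ℕ → Set
MinDegreeAtLeast G d = ∀ v → d ≤ degree G v

-- Perfect matching of G restricted to the vertex set W, encoded by the
-- partner map: each vertex of W is matched to exactly one other vertex of W
-- along an edge (m is a fixed-point-free involution on W).
PerfectMatchingOn : ∀ {n} → Graph n → Subset n → Set
PerfectMatchingOn {n} G W = Σ (Fin n → Fin n) λ m →
  ∀ x → x ∈ W → (m x ∈ W × adj G x (m x) ≡ true × m (m x) ≡ x)

without2 : ∀ {n} → Fin n → Fin n → Subset n
without2 u v = tabulate λ x → Data.Bool.not (⌊ x ≟ u ⌋ ∨ ⌊ x ≟ v ⌋)
  where import Data.Bool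

BiCritical : ∀ {n} → Graph n → Set
BiCritical G = ∀ u v → u ≢ v → PerfectMatchingOn G (without2 u v)

{-# OPTIONS --safe #-}
module Submission where

open import Defs
open import Data.Nat using (ℕ; zero; suc; _+_; _*_; _∸_; _≤_; _<_; z≤n; s≤s)
import Data.Nat.Properties as ℕ
import Data.Empty as Empty
open import Data.Nat.Divisibility using (_∣_; divides)
open import Data.Bool using (Bool; true; false; _∨_; _∧_; not)
import Data.Bool.Properties as Bool
open import Data.Fin as Fin using (Fin; zero; suc; toℕ; fromℕ; inject₁)
open import Data.Fin.Properties as Fin using (_≟_)
open import Data.Fin.Subset
  using (Subset; _∈_; ∣_∣; ⊤; ⊥; ⁅_⁆; _∪_; ∁; _-_; inside; outside)
import Data.Fin.Subset.Properties as Subset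
open import Data.List.Base using (List; []; _∷_; length; allFin)
import Data.List.Properties as List
open import Data.List.Membership.Propositional using () renaming (_∈_ to _∈ˡ_)
open import Data.List.Membership.Propositional.Properties using (∈-allFin)
open import Data.List.Relation.Binary.Permutation.Propositional
  using (_↭_; ↭-refl; ↭-sym; ↭-trans; prep; swap; ↭⇒↭ₛ)
open import Data.List.Relation.Binary.Permutation.Propositional.Properties
  using (∈-resp-↭; ↭-length)
import Data.List.Relation.Binary.Permutation.Setoid.Properties as Permutationₛ
open import Data.List.Relation.Unary.All as All using (All; []; _∷_)
open import Data.List.Relation.Unary.AllPairs using ([]; _∷_)
open import Data.List.Relation.Unary.Any using (here; there)
open import Data.List.Relation.Unary.Unique.Propositional using (Unique)
open import Data.List.Relation.Unary.Unique.Propositional.Properties using (allFin⁺)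
open import Data.Product using (Σ; _×_; ∃; ∃₂; ∃-syntax; _,_; proj₁; proj₂)
open import Data.Sum using (_⊎_; inj₁; inj₂; [_,_]′)
open import Data.Vec.Base using ([]; _∷_; here; there; tabulate)
open import Data.Vec.Properties using (lookup∘tabulate; []=⇒lookup; lookup⇒[]=)
open import Function.Base using (id; _∘_; case_of_)
open import Function.Bundles using (_⇔_; mk⇔)
open import Relation.Binary.Definitions using (tri<; tri≈; tri>)
open import Relation.Binary.PropositionalEquality as ≡
  using (_≡_; _≢_; refl; trans; cong; subst; ≢-sym)
open import Relation.Nullary using (¬_; Dec; yes; no; contradiction; does)
open import Relation.Nullary.Decidable
  using (⌊_⌋; isYes≗does; dec-true; dec-false; does-⇔; ¬?; _×-dec_; _⊎-dec_)

-- For k = 1, 2 a nonadjacent pair always contains a vertex adjacent to all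
-- others: the complement of G is a disjoint union of stars. If x, y are left
-- unmatched in G - S and y sees everything but x, then a neighbour z of x (one
-- exists since δ ≥ 3), matched to w, gives the augmentation xz, wy.
-- For k ≥ 3 blow up the vertices of the cycle C_(k+2) to cliques: all such graphs
-- are k-γc-critical and claw-free, and with two singleton classes around a
-- clique of odd size, deleting the singletons leaves an odd component.

-- The path `x`, `z`, `w`, `y` is augmenting of length three, so no long alternating paths have to
-- be searched: unmatched vertices, whose number is even, disappear two at a time. The length
-- `k + 2` arises because a connected dominating set of a cycle can omit at most two vertices, while
-- a chord lets a third be omitted. Both facts pass to a blow-up: a vertex set projects to classes
-- without growing, and representatives lift a set of classes back. Adjacency of distinct vertices
-- depends only on their classes, so the class sizes stay free to be chosen for parity and minimum
-- degree.

∈-tabulate⁺ : ∀ {n} (f : Fin n → Bool) {x} → f x ≡ true → x ∈ tabulate f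
∈-tabulate⁺ f {x} fx = lookup⇒[]= x _ (trans (lookup∘tabulate f x) fx)

∈-tabulate⁻ : ∀ {n} (f : Fin n → Bool) {x} → x ∈ tabulate f → f x ≡ true
∈-tabulate⁻ f {x} x∈ = trans (≡.sym (lookup∘tabulate f x)) ([]=⇒lookup x∈)

⌊⌋-true : ∀ {A : Set} (a? : Dec A) → A → ⌊ a? ⌋ ≡ true
⌊⌋-true a? a = trans (isYes≗does a?) (dec-true a? a)

⌊⌋-false : ∀ {A : Set} (a? : Dec A) → ¬ A → ⌊ a? ⌋ ≡ false
⌊⌋-false a? ¬a = trans (isYes≗does a?) (dec-false a? ¬a)

∈-without2 : ∀ {n} (u v : Fin n) {x} → x ≢ u → x ≢ v → x ∈ without2 u v
∈-without2 u v {x} x≢u x≢v = ∈-tabulate⁺ _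
  (≡.cong₂ (λ b c → not (b ∨ c)) (⌊⌋-false (x ≟ u) x≢u) (⌊⌋-false (x ≟ v) x≢v))

without2-∉ : ∀ {n} (u v : Fin n) {x} → x ∈ without2 u v → x ≢ u × x ≢ v
without2-∉ u v {x} x∈ with x ≟ u | x ≟ v | ∈-tabulate⁻ _ x∈
... | no x≢u | no x≢v | _ = x≢u , x≢v

x∉p-x : ∀ {n} (p : Subset n) {x y} → y ∈ p - x → y ≢ x
x∉p-x (s ∷ p) {zero} () refl
x∉p-x (s ∷ p) {suc x} (there y∈) refl = x∉p-x p y∈ refl

∈p-x⁻ : ∀ {n} (p : Subset n) {x y} → y ∈ p - x → y ∈ p × y ≢ x
∈p-x⁻ p {x} y∈ = Subset.p─q⊆p p ⁅ x ⁆ y∈ , x∉p-x p y∈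

∣p∣≤1+∣p-x∣ : ∀ {n} (p : Subset n) x → ∣ p ∣ ≤ suc ∣ p - x ∣
∣p∣≤1+∣p-x∣ (inside  ∷ p) zero    = s≤s (ℕ.≤-reflexive (cong ∣_∣ (≡.sym (Subset.p─⊥≡p p))))
∣p∣≤1+∣p-x∣ (outside ∷ p) zero    = ℕ.m≤n⇒m≤1+n (ℕ.≤-reflexive (cong ∣_∣ (≡.sym (Subset.p─⊥≡p p))))
∣p∣≤1+∣p-x∣ (inside  ∷ p) (suc x) = s≤s (∣p∣≤1+∣p-x∣ p x)
∣p∣≤1+∣p-x∣ (outside ∷ p) (suc x) = ∣p∣≤1+∣p-x∣ p x

nonempty : ∀ {n} (p : Subset n) → 1 ≤ ∣ p ∣ → ∃ (_∈ p)
nonempty (inside  ∷ p) _   = zero , here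
nonempty (outside ∷ p) 1≤p with nonempty p 1≤p
... | x , x∈p = suc x , there x∈p

adj-≢ : ∀ {n} (G : Graph n) {x y} → adj G x y ≡ true → x ≢ y
adj-≢ G {x} xy refl = case trans (≡.sym xy) (irrefl G x) of λ ()

∈-front : ∀ {A : Set} {x : A} {xs} → x ∈ˡ xs → ∃[ ys ] xs ↭ x ∷ ys
∈-front (here refl) = _ , ↭-refl
∈-front (there x∈) with ∈-front x∈
... | ys , p = _ , ↭-trans (prep _ p) (swap _ _ ↭-refl)

Unique-resp-↭ : ∀ {A : Set} {xs ys : List A} → xs ↭ ys → Unique xs → Unique ys
Unique-resp-↭ p = Permutationₛ.Unique-resp-↭ (≡.setoid _) (↭⇒↭ₛ p)

-- Perfect matchings when the complement is a disjoint union of stars.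

-- A nonadjacent pair has an end adjacent to all other vertices; equivalently,
-- the complement is a disjoint union of stars.
CoStarForest : ∀ {n} → Graph n → Set
CoStarForest {n} G = ∀ u v → u ≢ v → adj G u v ≡ false →
  (∀ x → x ≢ u → x ≢ v → adj G u x ≡ true) ⊎ (∀ x → x ≢ u → x ≢ v → adj G v x ≡ true)

module Matchings {n} (G : Graph n) where

  -- Matching us xs: a matching of G[xs] whose unmatched vertices are us.
  data Matching (us xs : List (Fin n)) : Set where
    done : xs ↭ us → Matching us xs
    pair : ∀ {x y ys} → adj G x y ≡ true → xs ↭ x ∷ y ∷ ys → Matching us ys → Matching us xs

  resp-xs : ∀ {us xs xs′} → xs ↭ xs′ → Matching us xs → Matching us xs′
  resp-xs p (done q)      = done (↭-trans (↭-sym p) q)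
  resp-xs p (pair xy q M) = pair xy (↭-trans (↭-sym p) q) M

  resp-us : ∀ {us us′ xs} → us ↭ us′ → Matching us xs → Matching us′ xs
  resp-us p (done q)      = done (↭-trans q p)
  resp-us p (pair xy q M) = pair xy q (resp-us p M)

  remove : ∀ {x us xs} → Matching (x ∷ us) xs → ∃[ ys ] xs ↭ x ∷ ys × Matching us ys
  remove (done p) = _ , p , done ↭-refl
  remove {x} (pair {a} {b} ab p M) with remove M
  ... | zs , q , N = a ∷ b ∷ zs
    , ↭-trans p (↭-trans (prep a (prep b q)) (↭-trans (prep a (swap b x ↭-refl)) (swap a x ↭-refl)))
    , pair ab ↭-refl N

  partner : ∀ {us xs z} → Matching us xs → z ∈ˡ xs →
    z ∈ˡ us ⊎ ∃₂ λ w ys → adj G z w ≡ true × xs ↭ z ∷ w ∷ ys × Matching us ys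
  partner (done p) z∈ = inj₁ (∈-resp-↭ p z∈)
  partner {z = z} (pair {a} {b} ab p M) z∈ with ∈-resp-↭ p z∈
  ... | here refl         = inj₂ (b , _ , ab , p , M)
  ... | there (here refl) = inj₂ (a , _ , trans (sym G b a) ab , ↭-trans p (swap a b ↭-refl) , M)
  ... | there (there z∈ys) with partner M z∈ys
  ...   | inj₁ z∈us = inj₁ z∈us
  ...   | inj₂ (w , ys , zw , q , N) = inj₂ (w , a ∷ b ∷ ys , zw
          , ↭-trans p (↭-trans (prep a (prep b q)) (moveBack a b))
          , pair ab ↭-refl N)
    where
    moveBack : ∀ a b {z w ys} → a ∷ b ∷ z ∷ w ∷ ys ↭ z ∷ w ∷ a ∷ b ∷ ys
    moveBack a b = ↭-trans (prep a (swap b _ ↭-refl)) (↭-trans (swap a _ ↭-refl)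
      (prep _ (↭-trans (prep a (swap b _ ↭-refl)) (swap a _ ↭-refl))))

  -- With y adjacent to everything but x: if x has a neighbour z matched to w,
  -- replace zw by xz and wy.
  augment : ∀ {x y us xs} → Unique xs → Matching (x ∷ y ∷ us) xs →
    (∀ t → t ≢ x → t ≢ y → adj G y t ≡ true) →
    ∀ z → adj G x z ≡ true → z ≢ y → z ∈ˡ xs →
    ∃[ us′ ] length us′ ≡ length us × Matching us′ xs
  augment {x} {y} {us} uniq M y-adj z xz z≢y z∈ with partner M z∈
  ... | inj₁ (here z≡x) = contradiction (≡.sym z≡x) (adj-≢ G xz)
  ... | inj₁ (there (here z≡y)) = contradiction z≡y z≢y
  -- If `z` is itself unmatched, `xz` is added directly and `y` takes the place of `z`, so here too
  -- the number of unmatched vertices drops by two.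
  ... | inj₁ (there (there z∈us)) with ∈-front z∈us
  ...   | us′ , p with remove (resp-us (prep x (↭-trans (prep y p) (swap y z ↭-refl))) M)
  ...     | ys , q , N with remove N
  ...       | zs , r , L = y ∷ us′ , ≡.sym (↭-length p) , pair xz (↭-trans q (prep x r)) L
  augment {x} {y} {us} uniq M y-adj z xz z≢y z∈ | inj₂ (w , ys , zw , p , N) with remove N
  ... | zs , q , L with remove L
  ...   | ts , r , K = us , refl ,
          pair xz (↭-trans perm (↭-trans (prep z (swap w x ↭-refl)) (swap z x ↭-refl)))
            (pair wy ↭-refl K)
    where
    perm = ↭-trans p (prep z (prep w (↭-trans q (prep x r))))
    wy : adj G w y ≡ true
    wy with Unique-resp-↭ perm uniq
    ... | _ ∷ (w≢x ∷ w≢y ∷ _) ∷ _ = trans (sym G w y) (y-adj w w≢x w≢y)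

  -- Induction on `h`, half the number of unmatched vertices. The first two either are adjacent and
  -- form a pair, or one of them sees everything but the other; then a neighbour of the other, which
  -- `nbr` keeps inside `xs`, starts the augmentation.
  perfect : CoStarForest G → ∀ {xs} → Unique xs →
    (∀ x → x ∈ˡ xs → ∃[ z ] z ∈ˡ xs × adj G x z ≡ true) →
    ∀ h us → length us ≡ h * 2 → Matching us xs → Matching [] xs
  perfect G* uniq nbr zero [] _ M = M
  perfect G* {xs} uniq nbr (suc h) (x ∷ y ∷ us) |us| M = go (adj G x y Bool.≟ true)
    where
    |us|′ : length us ≡ h * 2
    |us|′ = cong (λ k → k ∸ 2) |us|
    R : ∃[ ys ] xs ↭ x ∷ y ∷ ys × Matching us ys
    R with remove M
    ... | ys , p , N with remove N
    ...   | zs , q , L = zs , ↭-trans p (prep x q) , L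
    perm = proj₁ (proj₂ R)
    x≢y : x ≢ y
    x≢y with Unique-resp-↭ perm uniq
    ... | (x≢y ∷ _) ∷ _ = x≢y
    x∈ : x ∈ˡ xs
    x∈ = ∈-resp-↭ (↭-sym perm) (here refl)
    y∈ : y ∈ˡ xs
    y∈ = ∈-resp-↭ (↭-sym perm) (there (here refl))
    recurse : ∃[ us′ ] length us′ ≡ length us × Matching us′ xs → Matching [] xs
    recurse (us′ , |us′| , M′) = perfect G* uniq nbr h us′ (trans |us′| |us|′) M′
    ≢-of : ∀ {a b c} → adj G a b ≡ false → adj G a c ≡ true → c ≢ b
    ≢-of ab ac refl = case trans (≡.sym ab) ac of λ ()
    go : Dec (adj G x y ≡ true) → Matching [] xs
    go (yes xy) = perfect G* uniq nbr h us |us|′ (pair xy perm (proj₂ (proj₂ R)))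
    go (no ¬xy) with Bool.¬-not ¬xy
    ... | xy with G* x y x≢y xy | nbr x x∈ | nbr y y∈
    ...   | inj₂ y-adj | z , z∈ , xz | _ =
            recurse (augment uniq M (λ t → y-adj t) z xz (≢-of xy xz) z∈)
    ...   | inj₁ x-adj | _ | z , z∈ , yz =
            recurse (augment uniq (resp-us (swap x y ↭-refl) M) (λ t t≢y t≢x → x-adj t t≢x t≢y) z yz
              (≢-of (trans (sym G y x) xy) yz) z∈)

  -- Each pair extends the partner map of the remaining list by exchanging `a` and `b`; `Unique`
  -- keeps `a` and `b` out of that list, so the old values survive there.
  involution : ∀ {xs} → Unique xs → Matching [] xs →
    Σ (Fin n → Fin n) λ m → ∀ x → x ∈ˡ xs → m x ∈ˡ xs × adj G x (m x) ≡ true × m (m x) ≡ x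
  involution uniq (done p) = id , λ x x∈ → case ∈-resp-↭ p x∈ of λ ()
  involution {xs} uniq (pair {a} {b} {ys} ab p M) with Unique-resp-↭ p uniq
  ... | (a≢b ∷ a#ys) ∷ b#ys ∷ uniq′ with involution uniq′ M
  ...   | m′ , m′-ok = m , λ x x∈ → ok x (∈-resp-↭ p x∈)
    where
    m : Fin n → Fin n
    m x with x ≟ a | x ≟ b
    ... | yes _ | _     = b
    ... | no _  | yes _ = a
    ... | no _  | no _  = m′ x
    ma : m a ≡ b
    ma with a ≟ a | a ≟ b
    ... | yes _  | _ = refl
    ... | no a≢a | _ = contradiction refl a≢a
    mb : m b ≡ a
    mb with b ≟ a | b ≟ b
    ... | yes b≡a | _      = b≡a
    ... | no _    | yes _  = refl
    ... | no _    | no b≢b = contradiction refl b≢b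
    mys : ∀ {x} → x ∈ˡ ys → m x ≡ m′ x
    mys {x} x∈ with x ≟ a | x ≟ b
    ... | yes x≡a | _       = contradiction (≡.sym x≡a) (All.lookup a#ys x∈)
    ... | no _    | yes x≡b = contradiction (≡.sym x≡b) (All.lookup b#ys x∈)
    ... | no _    | no _    = refl
    back : ∀ {x} → x ∈ˡ a ∷ b ∷ ys → x ∈ˡ xs
    back = ∈-resp-↭ (↭-sym p)
    ok : ∀ x → x ∈ˡ a ∷ b ∷ ys → m x ∈ˡ xs × adj G x (m x) ≡ true × m (m x) ≡ x
    ok x (here refl) = subst (λ t → t ∈ˡ xs × adj G a t ≡ true × m t ≡ a) (≡.sym ma)
      (back (there (here refl)) , ab , mb)
    ok x (there (here refl)) = subst (λ t → t ∈ˡ xs × adj G b t ≡ true × m t ≡ b) (≡.sym mb)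
      (back (here refl) , trans (sym G b a) ab , ma)
    ok x (there (there x∈)) with m′-ok x x∈
    ... | m′x∈ , xm′ , m′m′ = subst (λ t → t ∈ˡ xs × adj G x t ≡ true × m t ≡ x) (≡.sym (mys x∈))
      (back (there (there m′x∈)) , xm′ , trans (mys m′x∈) m′m′)

-- This is where minimum degree 3 enters: deleting two vertices costs any vertex at most two
-- neighbours.
third-neighbour : ∀ {n} (G : Graph n) → MinDegreeAtLeast G 3 → ∀ u v x →
  ∃[ z ] z ≢ u × z ≢ v × adj G x z ≡ true
third-neighbour G δ u v x = from (nonempty (N - u - v) (ℕ.≤-pred (ℕ.≤-pred
    (ℕ.≤-trans (δ x) (ℕ.≤-trans (∣p∣≤1+∣p-x∣ N u) (s≤s (∣p∣≤1+∣p-x∣ (N - u) v)))))))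
  where
  N = tabulate (adj G x)
  from : ∃ (_∈ N - u - v) → ∃[ z ] z ≢ u × z ≢ v × adj G x z ≡ true
  from (z , z∈) with ∈p-x⁻ (N - u) z∈
  ... | z∈N-u , z≢v with ∈p-x⁻ N z∈N-u
  ...   | z∈N , z≢u = z , z≢u , z≢v , ∈-tabulate⁻ _ z∈N

coStarForest-biCritical : ∀ {n} (G : Graph n) → CoStarForest G → 2 ∣ n →
  MinDegreeAtLeast G 3 → BiCritical G
coStarForest-biCritical G G* (divides zero refl) δ ()
coStarForest-biCritical {n} G G* (divides (suc h) n≡) δ u v u≢v with ∈-front (∈-allFin u)
... | ys , p with ∈-resp-↭ p (∈-allFin v)
...   | here v≡u = contradiction (≡.sym v≡u) u≢v
...   | there v∈ys with ∈-front v∈ys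
-- The start is the empty matching, with all `h * 2` remaining vertices unmatched.
...     | xs , q = matching (involution uniq (perfect G* uniq nbr h xs |xs| (done ↭-refl)))
  where
  open Matchings G
  perm : allFin n ↭ u ∷ v ∷ xs
  perm = ↭-trans p (prep u q)
  |xs| : length xs ≡ h * 2
  |xs| = cong (λ k → k ∸ 2) (trans (≡.sym (↭-length perm)) (trans (List.length-tabulate id) n≡))
  distinct : Unique (u ∷ v ∷ xs)
  distinct = Unique-resp-↭ perm (allFin⁺ n)
  uniq : Unique xs
  uniq with distinct
  ... | _ ∷ _ ∷ uniq = uniq
  ∈xs : ∀ {x} → x ≢ u → x ≢ v → x ∈ˡ xs
  ∈xs {x} x≢u x≢v with ∈-resp-↭ perm (∈-allFin x)
  ... | here x≡u         = contradiction x≡u x≢u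
  ... | there (here x≡v) = contradiction x≡v x≢v
  ... | there (there x∈) = x∈
  ∈xs⁻ : ∀ {x} → x ∈ˡ xs → x ∈ without2 u v
  ∈xs⁻ x∈ with distinct
  ... | (_ ∷ u#xs) ∷ v#xs ∷ _ =
    ∈-without2 u v (≢-sym (All.lookup u#xs x∈)) (≢-sym (All.lookup v#xs x∈))
  nbr : ∀ x → x ∈ˡ xs → ∃[ z ] z ∈ˡ xs × adj G x z ≡ true
  nbr x _ with third-neighbour G δ u v x
  ... | z , z≢u , z≢v , xz = z , ∈xs z≢u z≢v , xz
  matching : Σ (Fin n → Fin n) (λ m → ∀ x → x ∈ˡ xs → m x ∈ˡ xs × adj G x (m x) ≡ true × m (m x) ≡ x) →
    PerfectMatchingOn G (without2 u v)
  matching (m , m-ok) = m , λ x x∈ → case without2-∉ u v x∈ of λ where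
    (x≢u , x≢v) → case m-ok x (∈xs x≢u x≢v) of λ where
      (mx∈ , xmx , mmx) → ∈xs⁻ mx∈ , xmx , mmx

-- Critical graphs for k = 1 and k = 2.

x∈p⇒1≤∣p∣ : ∀ {n} {p : Subset n} {x} → x ∈ p → 1 ≤ ∣ p ∣
x∈p⇒1≤∣p∣ x∈p = ℕ.≤-trans (s≤s z≤n) (Subset.x∈p⇒∣p-x∣<∣p∣ x∈p)

∣p∣<2⇒unique : ∀ {n} {p : Subset n} → ∣ p ∣ < 2 → ∀ {x y} → x ∈ p → y ∈ p → x ≡ y
∣p∣<2⇒unique p<2 {x} {y} x∈p y∈p with x ≟ y
... | yes x≡y = x≡y
... | no x≢y  = contradiction
  (ℕ.≤-trans (s≤s (x∈p⇒1≤∣p∣ (Subset.x∈p∧x≢y⇒x∈p-y x∈p x≢y))) (Subset.x∈p⇒∣p-x∣<∣p∣ y∈p))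
  (ℕ.<⇒≱ p<2)

addEdge⁻ : ∀ {n} (a : Adj n) {u v x y} → addEdge a u v x y ≡ true →
  a x y ≡ true ⊎ (x ≡ u × y ≡ v) ⊎ (x ≡ v × y ≡ u)
addEdge⁻ a {u} {v} {x} {y} xy with a x y | x ≟ u | y ≟ v | x ≟ v | y ≟ u
... | true  | _       | _       | _       | _       = inj₁ refl
... | false | yes x≡u | yes y≡v | _       | _       = inj₂ (inj₁ (x≡u , y≡v))
... | false | _       | _       | yes x≡v | yes y≡u = inj₂ (inj₂ (x≡v , y≡u))
addEdge⁻ _ () | false | yes _ | no _  | yes _ | no _
addEdge⁻ _ () | false | yes _ | no _  | no _  | _
addEdge⁻ _ () | false | no _  | _     | yes _ | no _
addEdge⁻ _ () | false | no _  | _     | no _  | _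

addEdge⁺ : ∀ {n} (a : Adj n) {u v x y} →
  a x y ≡ true ⊎ (x ≡ u × y ≡ v) ⊎ (x ≡ v × y ≡ u) → addEdge a u v x y ≡ true
addEdge⁺ a (inj₁ xy) rewrite xy = refl
addEdge⁺ a {u} {v} (inj₂ (inj₁ (refl , refl)))
  rewrite ⌊⌋-true (u ≟ u) refl | ⌊⌋-true (v ≟ v) refl = Bool.∨-zeroʳ _
addEdge⁺ a {u} {v} (inj₂ (inj₂ (refl , refl)))
  rewrite ⌊⌋-true (u ≟ u) refl | ⌊⌋-true (v ≟ v) refl
        | Bool.∨-zeroʳ (⌊ v ≟ u ⌋ ∧ ⌊ u ≟ v ⌋) = Bool.∨-zeroʳ _

-- For k = 1 no nonadjacent pair exists, as a connected dominating set is nonempty. For k = 2 a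
-- single vertex `w` dominates after `uv` is added; it does not dominate `G`, so it relies on the
-- new edge and is `u` or `v`.
critical⇒coStarForest : ∀ {n} (G : Graph n) {k} → k ≡ 1 ⊎ k ≡ 2 → Critical G k → CoStarForest G
critical⇒coStarForest G (inj₁ refl) (_ , crit) u v u≢v uv with crit u v u≢v uv
... | D , (_ , (w , w∈D) , _) , |D|<1 = contradiction (x∈p⇒1≤∣p∣ w∈D) (ℕ.<⇒≱ |D|<1)
critical⇒coStarForest {n} G (inj₂ refl) ((_ , ¬γ<2) , crit) u v u≢v uv with crit u v u≢v uv
... | D , (dom , (w , w∈D) , _) , |D|<2 = go (w ≟ u) (w ≟ v)
  where
  near-w : ∀ x → x ≢ w → addEdge (adj G) u v x w ≡ true
  near-w x x≢w with dom x
  ... | inj₁ x∈D = contradiction (∣p∣<2⇒unique |D|<2 x∈D w∈D) x≢w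
  ... | inj₂ (y , y∈D , xy) with ∣p∣<2⇒unique |D|<2 y∈D w∈D
  ...   | refl = xy
  go : Dec (w ≡ u) → Dec (w ≡ v) →
    (∀ x → x ≢ u → x ≢ v → adj G u x ≡ true) ⊎ (∀ x → x ≢ u → x ≢ v → adj G v x ≡ true)
  go (yes refl) _ = inj₁ λ x x≢u x≢v → case addEdge⁻ (adj G) (near-w x x≢u) of λ where
    (inj₁ xu)               → trans (sym G u x) xu
    (inj₂ (inj₁ (x≡u , _))) → contradiction x≡u x≢u
    (inj₂ (inj₂ (x≡v , _))) → contradiction x≡v x≢v
  go (no _) (yes refl) = inj₂ λ x x≢u x≢v → case addEdge⁻ (adj G) (near-w x x≢v) of λ where
    (inj₁ xv)               → trans (sym G v x) xv
    (inj₂ (inj₁ (x≡u , _))) → contradiction x≡u x≢u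
    (inj₂ (inj₂ (x≡v , _))) → contradiction x≡v x≢v
  go (no w≢u) (no w≢v) = contradiction
    (⁅ w ⁆ , (dominates , (w , Subset.x∈⁅x⁆ w) , connected) , ℕ.≤-reflexive (cong suc (Subset.∣⁅x⁆∣≡1 w)))
    ¬γ<2
    where
    dominates : Dominating (adj G) ⁅ w ⁆
    dominates x with x ≟ w
    ... | yes refl = inj₁ (Subset.x∈⁅x⁆ w)
    ... | no x≢w with addEdge⁻ (adj G) (near-w x x≢w)
    ...   | inj₁ xw               = inj₂ (w , Subset.x∈⁅x⁆ w , xw)
    ...   | inj₂ (inj₁ (_ , w≡v)) = contradiction w≡v w≢v
    ...   | inj₂ (inj₂ (_ , w≡u)) = contradiction w≡u w≢u
    connected : ∀ x y → x ∈ ⁅ w ⁆ → y ∈ ⁅ w ⁆ → WalkIn (adj G) ⁅ w ⁆ x y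
    connected x y x∈ y∈ with Subset.x∈⁅y⁆⇒x≡y w x∈ | Subset.x∈⁅y⁆⇒x≡y w y∈
    ... | refl | refl = here

-- The cycle on `Fin (suc m)`: descent, adjacency and intervals.

prev : ∀ {m} → Fin (suc m) → Fin (suc m)
prev {m} zero = fromℕ m
prev (suc x)  = inject₁ x

prev-injective : ∀ {m} {x y : Fin (suc m)} → prev x ≡ prev y → x ≡ y
prev-injective {x = zero}  {zero}  _  = refl
prev-injective {x = zero}  {suc y} eq = contradiction eq Fin.fromℕ≢inject₁
prev-injective {x = suc x} {zero}  eq = contradiction (≡.sym eq) Fin.fromℕ≢inject₁
prev-injective {x = suc x} {suc y} eq = cong suc (Fin.inject₁-injective eq)

data _↘_ {m} : (x y : Fin (suc m)) → Set where
  stop : ∀ {x} → x ↘ x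
  down : ∀ {x y} → prev x ↘ y → x ↘ y

↘-trans : ∀ {m} {x y z : Fin (suc m)} → x ↘ y → y ↘ z → x ↘ z
↘-trans stop     s = s
↘-trans (down r) s = down (↘-trans r s)

≤⇒↘ : ∀ {m} d (x y : Fin (suc m)) → toℕ x ≡ d + toℕ y → x ↘ y
≤⇒↘ zero    x       y eq = subst (x ↘_) (Fin.toℕ-injective eq) stop
≤⇒↘ (suc d) (suc x) y eq =
  down (≤⇒↘ d (inject₁ x) y (trans (Fin.toℕ-inject₁ x) (ℕ.suc-injective eq)))

-- Descend from `x` to `zero`, wrap to the top, descend to `y`. The route may already pass `y` on
-- the first stretch.
cyclic : ∀ {m} (x y : Fin (suc m)) → x ↘ y
cyclic {m} x y = ↘-trans (≤⇒↘ (toℕ x) x zero (≡.sym (ℕ.+-identityʳ _)))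
  (down (≤⇒↘ (toℕ (fromℕ m) ∸ toℕ y) (fromℕ m) y (≡.sym (ℕ.m∸n+n≡m (Fin.≤fromℕ y)))))

-- Equality is included so that the vertices of one class form a clique.
Near : ∀ {m} → Fin (suc m) → Fin (suc m) → Set
Near x y = x ≡ y ⊎ prev x ≡ y ⊎ prev y ≡ x

near? : ∀ {m} (x y : Fin (suc m)) → Dec (Near x y)
near? x y = x ≟ y ⊎-dec prev x ≟ y ⊎-dec prev y ≟ x

Near-sym : ∀ {m} {x y : Fin (suc m)} → Near x y → Near y x
Near-sym (inj₁ x≡y)         = inj₁ (≡.sym x≡y)
Near-sym (inj₂ (inj₁ px≡y)) = inj₂ (inj₂ px≡y)
Near-sym (inj₂ (inj₂ py≡x)) = inj₂ (inj₁ py≡x)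

Between : ∀ {m} → Fin m → Fin m → Fin m → Set
Between p q x = p Fin.< x × x Fin.< q

-- A point strictly between `p` and `q` is neither `zero` nor the top, so the wrap-around edge
-- cannot be taken and a unit step leaves the interval only through `p` or `q`.
Between-near : ∀ {m} {p q x y : Fin (suc m)} →
  Between p q x → Near x y → y ≢ p → y ≢ q → Between p q y
Between-near p<x<q (inj₁ refl) _ _ = p<x<q
Between-near {x = suc x} (p<x , x<q) (inj₂ (inj₁ refl)) y≢p _ =
    Fin.≤∧≢⇒< (subst (_ ≤_) (≡.sym (Fin.toℕ-inject₁ x)) (ℕ.≤-pred p<x)) (≢-sym y≢p)
  , subst (_< _) (≡.sym (Fin.toℕ-inject₁ x)) (ℕ.<⇒≤ x<q)
Between-near {q = q} {y = zero} (_ , x<q) (inj₂ (inj₂ top≡x)) _ _ =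
  contradiction (Fin.≤fromℕ q) (ℕ.<⇒≱ (subst (Fin._< q) (≡.sym top≡x) x<q))
Between-near {p = p} {q} {y = suc y} (p<x , x<q) (inj₂ (inj₂ y≡x)) _ y≢q =
    ℕ.m≤n⇒m≤1+n (subst (toℕ p <_) x≡y p<x)
  , Fin.≤∧≢⇒< (subst (_< toℕ q) x≡y x<q) y≢q
  where
  x≡y = trans (cong toℕ (≡.sym y≡x)) (Fin.toℕ-inject₁ y)

module _ {j : ℕ} where

  prev≢ : (x : Fin (5 + j)) → prev x ≢ x
  prev≢ zero    ()
  prev≢ (suc x) eq = ℕ.1+n≢n (≡.sym (trans (≡.sym (Fin.toℕ-inject₁ x)) (cong toℕ eq)))

  prev²≢ : (x : Fin (5 + j)) → prev (prev x) ≢ x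
  prev²≢ zero          ()
  prev²≢ (suc zero)    ()
  prev²≢ (suc (suc x)) eq = ℕ.m≢1+n+m (toℕ x)
    (trans (≡.sym (trans (Fin.toℕ-inject₁ _) (Fin.toℕ-inject₁ x))) (cong toℕ eq))

  -- Fails on a cycle of length 4; it ensures that two classes cannot each lie two steps below the
  -- other.
  prev⁴≢ : (x : Fin (5 + j)) → prev (prev (prev (prev x))) ≢ x
  prev⁴≢ zero                      ()
  prev⁴≢ (suc zero)                ()
  prev⁴≢ (suc (suc zero))          ()
  prev⁴≢ (suc (suc (suc zero)))    ()
  prev⁴≢ (suc (suc (suc (suc x)))) eq = ℕ.m≢1+n+m (toℕ x) (trans (≡.sym toℕ-eq) (cong toℕ eq))
    where
    toℕ-eq = trans (Fin.toℕ-inject₁ _) (trans (Fin.toℕ-inject₁ _)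
      (trans (Fin.toℕ-inject₁ _) (Fin.toℕ-inject₁ x)))

-- Images and ordered enumeration of subsets; walks.

image : ∀ {m n} → (Fin n → Fin m) → Subset n → Subset m
image f []            = ⊥
image f (inside  ∷ p) = ⁅ f zero ⁆ ∪ image (f ∘ suc) p
image f (outside ∷ p) = image (f ∘ suc) p

∈-image⁺ : ∀ {m n} (f : Fin n → Fin m) {p x} → x ∈ p → f x ∈ image f p
∈-image⁺ f {inside  ∷ p} here       = Subset.x∈p∪q⁺ (inj₁ (Subset.x∈⁅x⁆ _))
∈-image⁺ f {inside  ∷ p} (there x∈) = Subset.x∈p∪q⁺ (inj₂ (∈-image⁺ (f ∘ suc) x∈))
∈-image⁺ f {outside ∷ p} (there x∈) = ∈-image⁺ (f ∘ suc) x∈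

∈-image⁻ : ∀ {m n} (f : Fin n → Fin m) p {y} → y ∈ image f p → ∃[ x ] x ∈ p × f x ≡ y
∈-image⁻ f []            y∈ = contradiction y∈ Subset.∉⊥
∈-image⁻ f (inside  ∷ p) y∈ with Subset.x∈p∪q⁻ _ _ y∈
... | inj₁ y∈⁅f0⁆ = zero , here , ≡.sym (Subset.x∈⁅y⁆⇒x≡y _ y∈⁅f0⁆)
... | inj₂ y∈fp with ∈-image⁻ (f ∘ suc) p y∈fp
...   | x , x∈p , fx≡y = suc x , there x∈p , fx≡y
∈-image⁻ f (outside ∷ p) y∈ with ∈-image⁻ (f ∘ suc) p y∈
... | x , x∈p , fx≡y = suc x , there x∈p , fx≡y

∣p∪q∣≤∣p∣+∣q∣ : ∀ {n} (p q : Subset n) → ∣ p ∪ q ∣ ≤ ∣ p ∣ + ∣ q ∣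
∣p∪q∣≤∣p∣+∣q∣ []            []            = z≤n
∣p∪q∣≤∣p∣+∣q∣ (outside ∷ p) (outside ∷ q) = ∣p∪q∣≤∣p∣+∣q∣ p q
∣p∪q∣≤∣p∣+∣q∣ (inside  ∷ p) (outside ∷ q) = s≤s (∣p∪q∣≤∣p∣+∣q∣ p q)
∣p∪q∣≤∣p∣+∣q∣ (outside ∷ p) (inside  ∷ q) =
  ℕ.≤-trans (s≤s (∣p∪q∣≤∣p∣+∣q∣ p q)) (ℕ.≤-reflexive (≡.sym (ℕ.+-suc _ _)))
∣p∪q∣≤∣p∣+∣q∣ (inside  ∷ p) (inside  ∷ q) =
  s≤s (ℕ.≤-trans (∣p∪q∣≤∣p∣+∣q∣ p q) (ℕ.+-monoʳ-≤ _ (ℕ.n≤1+n _)))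

∣image∣≤ : ∀ {m n} (f : Fin n → Fin m) p → ∣ image f p ∣ ≤ ∣ p ∣
∣image∣≤ {m} f []        = ℕ.≤-reflexive (Subset.∣⊥∣≡0 m)
∣image∣≤ f (outside ∷ p) = ∣image∣≤ (f ∘ suc) p
∣image∣≤ f (inside ∷ p)  = ℕ.≤-trans (∣p∪q∣≤∣p∣+∣q∣ ⁅ f zero ⁆ (image (f ∘ suc) p))
  (ℕ.+-mono-≤ (ℕ.≤-reflexive (Subset.∣⁅x⁆∣≡1 (f zero))) (∣image∣≤ (f ∘ suc) p))

-- The increasing order lets three missed classes serve as end points for `Between`.
enumerate : ∀ {n} (p : Subset n) k → k ≤ ∣ p ∣ →
  Σ (Fin k → Fin n) λ f → (∀ i → f i ∈ p) × (∀ {i j} → i Fin.< j → f i Fin.< f j)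
enumerate p zero _ = (λ ()) , (λ ()) , λ {i} _ → contradiction i Fin.¬Fin0
enumerate (outside ∷ p) (suc k) k<p with enumerate p (suc k) k<p
... | f , f∈ , f-mono = suc ∘ f , there ∘ f∈ , s≤s ∘ f-mono
enumerate (inside ∷ p) (suc k) (s≤s k≤p) with enumerate p k k≤p
... | f , f∈ , f-mono = g , g∈ , g-mono
  where
  g : Fin (suc k) → Fin _
  g zero    = zero
  g (suc i) = suc (f i)
  g∈ : ∀ i → g i ∈ inside ∷ p
  g∈ zero    = here
  g∈ (suc i) = there (f∈ i)
  g-mono : ∀ {i j} → i Fin.< j → g i Fin.< g j
  g-mono {zero}  {suc j} _         = s≤s z≤n
  g-mono {suc i} {suc j} (s≤s i<j) = s≤s (f-mono i<j)

2+∣⊤-x-y∣≤ : ∀ {m} {x y : Fin m} → x ≢ y → 2 + ∣ ⊤ - x - y ∣ ≤ m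
2+∣⊤-x-y∣≤ {m} {x} x≢y = ℕ.≤-trans
  (s≤s (Subset.x∈p⇒∣p-x∣<∣p∣ (Subset.x∈p∧x≢y⇒x∈p-y Subset.∈⊤ (≢-sym x≢y))))
  (ℕ.≤-trans (Subset.x∈p⇒∣p-x∣<∣p∣ (Subset.∈⊤ {x = x})) (ℕ.≤-reflexive (Subset.∣⊤∣≡n m)))

reverse : ∀ {n} {a : Adj n} → (∀ x y → a x y ≡ true → a y x ≡ true) →
  ∀ {D x y} → x ∈ D → WalkIn a D x y → WalkIn a D y x
reverse {a = a} a-sym {D} x∈ w = go x∈ w here
  where
  go : ∀ {x y z} → x ∈ D → WalkIn a D x y → WalkIn a D x z → WalkIn a D y z
  go x∈ here            acc = acc
  go x∈ (step xv v∈ vw) acc = go v∈ vw (step (a-sym _ _ xv) x∈ acc)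

append : ∀ {n} {a : Adj n} {D x y z} → WalkIn a D x y → WalkIn a D y z → WalkIn a D x z
append here             w′ = w′
append (step xv v∈D vw) w′ = step xv v∈D (append vw w′)

IsCDS-mono : ∀ {n} {a b : Adj n} {D : Subset n} →
  (∀ {x y} → a x y ≡ true → b x y ≡ true) → IsCDS a D → IsCDS b D
IsCDS-mono {_} {a} {b} {D} a⊆b (dom , ne , conn) =
    (λ x → case dom x of λ where
      (inj₁ x∈D)            → inj₁ x∈D
      (inj₂ (y , y∈D , xy)) → inj₂ (y , y∈D , a⊆b xy))
  , ne , λ x y x∈ y∈ → walk (conn x y x∈ y∈)
  where
  walk : ∀ {x y} → WalkIn a D x y → WalkIn b D x y
  walk here            = here
  walk (step xv v∈ vw) = step (a⊆b xv) v∈ (walk vw)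

does-true⁻ : ∀ {A : Set} (a? : Dec A) → does a? ≡ true → A
does-true⁻ (yes a) _ = a

-- Blow-ups of cycles are claw-free and critical.

-- Blow-up of the cycle C_(5+j) into cliques; c x is the cycle vertex x is blown up from.
module CycleBlowUp {j n : ℕ} (c : Fin n → Fin (5 + j)) (sec : Fin (5 + j) → Fin n)
  (c-sec : ∀ κ → c (sec κ) ≡ κ) where

  adj? : (x y : Fin n) → Dec (x ≢ y × Near (c x) (c y))
  adj? x y = ¬? (x ≟ y) ×-dec near? (c x) (c y)

  blowUp : Graph n
  blowUp = record
    { adj    = λ x y → does (adj? x y)
    ; sym    = λ x y → does-⇔ (mk⇔ flip flip) (adj? x y) (adj? y x)
    ; irrefl = λ x → dec-false (adj? x x) λ (x≢x , _) → x≢x refl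
    }
    where
    flip : ∀ {x y} → x ≢ y × Near (c x) (c y) → y ≢ x × Near (c y) (c x)
    flip (x≢y , xy) = ≢-sym x≢y , Near-sym xy

  adj⁺ : ∀ {x y} → x ≢ y → Near (c x) (c y) → adj blowUp x y ≡ true
  adj⁺ x≢y xy = dec-true (adj? _ _) (x≢y , xy)

  adj⁻ : ∀ {x y} → adj blowUp x y ≡ true → Near (c x) (c y)
  adj⁻ {x} {y} xy = proj₂ (does-true⁻ (adj? x y) xy)

  nonadj⁻ : ∀ {x y} → x ≢ y → adj blowUp x y ≡ false → ¬ Near (c x) (c y)
  nonadj⁻ x≢y xy near = case trans (≡.sym xy) (adj⁺ x≢y near) of λ ()

  -- A leaf in the class of the centre would be adjacent to the other leaves. So the three leaves
  -- lie in the two neighbouring classes, and two of them share a class, which is a clique.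
  clawFree : ClawFree blowUp
  clawFree (o , x , y , z , x≢y , x≢z , y≢z , ox , oy , oz , xy , xz , yz) =
    case (strict (proj₁ o≢) ox , strict (proj₁ (proj₂ o≢)) oy , strict (proj₂ (proj₂ o≢)) oz) of λ where
      (inj₁ ox , inj₁ oy , _) → nonadj⁻ x≢y xy (inj₁ (trans (≡.sym ox) oy))
      (inj₁ ox , _ , inj₁ oz) → nonadj⁻ x≢z xz (inj₁ (trans (≡.sym ox) oz))
      (_ , inj₁ oy , inj₁ oz) → nonadj⁻ y≢z yz (inj₁ (trans (≡.sym oy) oz))
      (inj₂ ox , inj₂ oy , _) → nonadj⁻ x≢y xy (inj₁ (prev-injective (trans ox (≡.sym oy))))
      (inj₂ ox , _ , inj₂ oz) → nonadj⁻ x≢z xz (inj₁ (prev-injective (trans ox (≡.sym oz))))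
      (_ , inj₂ oy , inj₂ oz) → nonadj⁻ y≢z yz (inj₁ (prev-injective (trans oy (≡.sym oz))))
    where
    o≢ : c o ≢ c x × c o ≢ c y × c o ≢ c z
    o≢ = (λ ox → nonadj⁻ x≢y xy (subst (λ κ → Near κ (c y)) ox (adj⁻ oy)))
           , (λ oy → nonadj⁻ x≢y xy (Near-sym (subst (λ κ → Near κ (c x)) oy (adj⁻ ox))))
           , (λ oz → nonadj⁻ x≢z xz (Near-sym (subst (λ κ → Near κ (c x)) oz (adj⁻ ox))))
    strict : ∀ {v} → c o ≢ c v → adj blowUp o v ≡ true → prev (c o) ≡ c v ⊎ prev (c v) ≡ c o
    strict o≢v ov = [ (λ eq → contradiction eq o≢v) , id ]′ (adj⁻ ov)

  -- Three classes missed by D cut the cycle into three arcs; D, being connected,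
  -- lies in one of them and does not dominate the class between the other two.
  ¬γc< : ¬ γc< (adj blowUp) (3 + j)
  ¬γc< (D , (dom , _ , conn) , |D|<k) = separated
    where
    -- `D` meets at most `2 + j` of the `5 + j` classes.
    3≤missing : 3 ≤ ∣ ∁ (image c D) ∣
    3≤missing = subst (3 ≤_) (≡.sym (Subset.∣∁p∣≡n∸∣p∣ (image c D)))
      (ℕ.m+n≤o⇒m≤o∸n 3 (s≤s (s≤s (ℕ.≤-trans (s≤s (∣image∣≤ c D)) |D|<k))))
    three = enumerate (∁ (image c D)) 3 3≤missing
    f = proj₁ three
    f-mono : ∀ {i i′} → i Fin.< i′ → f i Fin.< f i′
    f-mono = proj₂ (proj₂ three)
    missing : ∀ i {x} → x ∈ D → c x ≢ f i
    missing i x∈D cx≡ = Subset.x∈∁p⇒x∉p (proj₁ (proj₂ three) i) (subst (_∈ image c D) cx≡ (∈-image⁺ c x∈D))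
    p = f zero
    q = f (suc zero)
    r = f (suc (suc zero))
    p<q : p Fin.< q
    p<q = f-mono (s≤s z≤n)
    q<r : q Fin.< r
    q<r = f-mono (s≤s (s≤s z≤n))
    dominator : ∀ i → ∃[ y ] y ∈ D × Near (f i) (c y)
    dominator i with dom (sec (f i))
    ... | inj₁ s∈D = contradiction (c-sec (f i)) (missing i s∈D)
    ... | inj₂ (y , y∈D , sy) = y , y∈D , subst (λ κ → Near κ (c y)) (c-sec (f i)) (adj⁻ sy)
    confined : ∀ i i′ {x y} → WalkIn (adj blowUp) D x y →
      Between (f i) (f i′) (c x) → Between (f i) (f i′) (c y)
    confined i i′ here            b = b
    confined i i′ (step xv v∈ vw) b =
      confined i i′ vw (Between-near b (adj⁻ xv) (missing i v∈) (missing i′ v∈))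
    captured : ∀ i i′ i″ {x} → x ∈ D → Between (f i) (f i′) (c x) → f i″ ≢ f i → f i″ ≢ f i′ →
      Between (f i) (f i′) (f i″)
    captured i i′ i″ x∈D b ≢₁ ≢₂ with dominator i″
    ... | y , y∈D , near =
      Between-near (confined i i′ (conn _ y x∈D y∈D) b) (Near-sym near) ≢₁ ≢₂
    separated : Empty.⊥
    -- Starting at the middle missed class `q` places `D` in one of the two arcs that do not wrap
    -- past `zero`, which `Between` can describe. Then `r` or `p`, respectively, is left
    -- undominated.
    separated with dominator (suc zero)
    ... | y , y∈D , near with Between-near (p<q , q<r) near (missing _ y∈D) (missing _ y∈D)
    ...   | p<y , y<r with Fin.<-cmp (c y) q
    ...     | tri< y<q _ _ = ℕ.<-asym q<r (proj₂ (captured zero (suc zero) (suc (suc zero)) y∈D (p<y , y<q)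
                (≢-sym (Fin.<⇒≢ (Fin.<-trans p<q q<r))) (≢-sym (Fin.<⇒≢ q<r))))
    ...     | tri≈ _ y≡q _ = missing _ y∈D y≡q
    ...     | tri> _ _ q<y = ℕ.<-asym p<q (proj₁ (captured (suc zero) (suc (suc zero)) zero y∈D (q<y , y<r)
                (Fin.<⇒≢ p<q) (Fin.<⇒≢ (Fin.<-trans p<q q<r))))

  -- `rep` may differ from `sec`: a set that uses an added edge `uv` must contain `u` and `v`
  -- themselves.
  module Representatives (rep : Fin (5 + j) → Fin n) (c-rep : ∀ κ → c (rep κ) ≡ κ) where

    Near-rep : ∀ {κ x} → Near (c x) κ → Near (c x) (c (rep κ))
    Near-rep {κ} {x} = subst (Near (c x)) (≡.sym (c-rep κ))

    -- Every representative walks to `rep i`: it steps to the class below while that belongs to `P`,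
    -- and otherwise jumps to `rep i` along an edge of `a`. Two such walks, one reversed, join any
    -- two members.
    image-CDS : ∀ {a : Adj n} → (∀ x y → a x y ≡ true → a y x ≡ true) →
      (∀ {x y} → adj blowUp x y ≡ true → a x y ≡ true) → ∀ {i P} → i ∈ P →
      (∀ κ → κ ∈ P → κ ≢ i → a (rep κ) (rep i) ≡ true ⊎ prev κ ∈ P) →
      (∀ κ → ∃[ κ′ ] κ′ ∈ P × Near κ κ′) →
      IsCDS a (image rep P)
    image-CDS {a} a-sym sub {i} {P} i∈P descend near-P =
      dominates , (rep i , ∈-image⁺ rep i∈P) , connected
      where
      dominates : Dominating a (image rep P)
      dominates x with near-P (c x)
      ... | κ , κ∈P , near with x ≟ rep κ
      ...   | yes refl = inj₁ (∈-image⁺ rep κ∈P)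
      ...   | no x≢    = inj₂ (rep κ , ∈-image⁺ rep κ∈P , sub (adj⁺ x≢ (Near-rep near)))
      to-i : ∀ {κ} → κ ↘ i → κ ∈ P → WalkIn a (image rep P) (rep κ) (rep i)
      to-i stop _ = here
      -- The route `r` may pass `i` before its end, and `descend` says nothing at `i`, so the walk
      -- stops at the first visit.
      to-i {κ} (down r) κ∈P with κ ≟ i
      ... | yes refl = here
      ... | no κ≢i with descend κ κ∈P κ≢i
      ...   | inj₁ κi  = step κi (∈-image⁺ rep i∈P) here
      ...   | inj₂ p∈P = step (sub (adj⁺ rep≢ near)) (∈-image⁺ rep p∈P) (to-i r p∈P)
        where
        rep≢ : rep κ ≢ rep (prev κ)
        rep≢ eq = prev≢ κ (trans (≡.sym (c-rep _)) (trans (cong c (≡.sym eq)) (c-rep κ)))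
        near : Near (c (rep κ)) (c (rep (prev κ)))
        near = Near-rep (inj₂ (inj₁ (cong prev (c-rep κ))))
      connected : ∀ x y → x ∈ image rep P → y ∈ image rep P → WalkIn a (image rep P) x y
      connected x y x∈ y∈ with ∈-image⁻ rep P x∈ | ∈-image⁻ rep P y∈
      ... | κ , κ∈P , refl | κ′ , κ′∈P , refl =
        append (to-i (cyclic κ i) κ∈P) (reverse a-sym y∈ (to-i (cyclic κ′ i) κ′∈P))

  -- Omitting two consecutive classes leaves a path that descends to class `zero`. Counting bounds
  -- its size from above, `¬γc<` from below.
  γc≡k : γc≡ (adj blowUp) (3 + j)
  γc≡k = (image sec P , cds , ℕ.≤-antisym |D|≤k (ℕ.≮⇒≥ λ |D|<k → ¬γc< (image sec P , cds , |D|<k))) , ¬γc<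
    where
    open Representatives sec c-sec
    i i⁻ i⁼ : Fin (5 + j)
    i  = zero
    i⁻ = prev i
    i⁼ = prev i⁻
    P = ⊤ - i⁻ - i⁼
    P⁺ : ∀ {κ} → κ ≢ i⁻ → κ ≢ i⁼ → κ ∈ P
    P⁺ ≢₁ ≢₂ = Subset.x∈p∧x≢y⇒x∈p-y (Subset.x∈p∧x≢y⇒x∈p-y Subset.∈⊤ ≢₁) ≢₂
    i∈P : i ∈ P
    i∈P = P⁺ (λ ()) (λ ())
    |D|≤k : ∣ image sec P ∣ ≤ 3 + j
    |D|≤k = ℕ.≤-trans (∣image∣≤ sec P) (ℕ.≤-pred (ℕ.≤-pred (2+∣⊤-x-y∣≤ (≢-sym (prev≢ i⁻)))))
    descend : ∀ κ → κ ∈ P → κ ≢ i → adj blowUp (sec κ) (sec i) ≡ true ⊎ prev κ ∈ P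
    descend κ κ∈P κ≢i with ∈p-x⁻ (⊤ - i⁻) {i⁼} κ∈P
    ... | κ∈ , _ = inj₂ (P⁺ (κ≢i ∘ prev-injective {y = i}) (proj₂ (∈p-x⁻ ⊤ κ∈) ∘ prev-injective {y = i⁻}))
    near-P : ∀ κ → ∃[ κ′ ] κ′ ∈ P × Near κ κ′
    near-P κ with κ ≟ i⁻ | κ ≟ i⁼
    ... | yes refl | _        = i , i∈P , inj₂ (inj₂ refl)
    ... | no _     | yes refl = prev i⁼ , P⁺ (prev²≢ i⁻) (prev≢ i⁼) , inj₂ (inj₁ refl)
    ... | no ≢₁    | no ≢₂    = κ , P⁺ ≢₁ ≢₂ , inj₁ refl
    cds : IsCDS (adj blowUp) (image sec P)
    cds = image-CDS (λ x y xy → trans (sym blowUp y x) xy) id i∈P descend near-P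

  -- All classes but the two below u and the one below v: every other class
  -- descends to that of u or v.
  γc<-addEdge : ∀ u v → u ≢ v → adj blowUp u v ≡ false → prev (prev (c u)) ≢ c v →
    γc< (addEdge (adj blowUp) u v) (3 + j)
  γc<-addEdge u v u≢v uv i⁼≢l = image rep P , cds , |D|<k
    where
    a = addEdge (adj blowUp) u v
    i i⁻ i⁼ l l⁻ : Fin (5 + j)
    i  = c u
    i⁻ = prev i
    i⁼ = prev i⁻
    l  = c v
    l⁻ = prev l
    ¬near : ¬ Near i l
    ¬near = nonadj⁻ u≢v uv
    i≢l : i ≢ l
    i≢l = ¬near ∘ inj₁
    rep : Fin (5 + j) → Fin n
    rep κ with κ ≟ i | κ ≟ l
    ... | yes _ | _     = u
    ... | no _  | yes _ = v
    ... | no _  | no _  = sec κ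
    c-rep : ∀ κ → c (rep κ) ≡ κ
    c-rep κ with κ ≟ i | κ ≟ l
    ... | yes κ≡i | _       = ≡.sym κ≡i
    ... | no _    | yes κ≡l = ≡.sym κ≡l
    ... | no _    | no _    = c-sec κ
    rep-i : rep i ≡ u
    rep-i with i ≟ i
    ... | yes _  = refl
    ... | no i≢i = contradiction refl i≢i
    rep-l : rep l ≡ v
    rep-l with l ≟ i | l ≟ l
    ... | yes l≡i | _      = contradiction (≡.sym l≡i) i≢l
    ... | no _    | yes _  = refl
    ... | no _    | no l≢l = contradiction refl l≢l
    open Representatives rep c-rep
    P = ⊤ - i⁻ - i⁼ - l⁻
    P⁺ : ∀ {κ} → κ ≢ i⁻ → κ ≢ i⁼ → κ ≢ l⁻ → κ ∈ P
    P⁺ ≢₁ ≢₂ ≢₃ = Subset.x∈p∧x≢y⇒x∈p-y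
      (Subset.x∈p∧x≢y⇒x∈p-y (Subset.x∈p∧x≢y⇒x∈p-y Subset.∈⊤ ≢₁) ≢₂) ≢₃
    l⁻≢i⁻ : l⁻ ≢ i⁻
    l⁻≢i⁻ eq = i≢l (≡.sym (prev-injective eq))
    l⁻≢i⁼ : l⁻ ≢ i⁼
    l⁻≢i⁼ eq = ¬near (inj₂ (inj₁ (≡.sym (prev-injective eq))))
    i∈P : i ∈ P
    i∈P = P⁺ (≢-sym (prev≢ i)) (≢-sym (prev²≢ i)) (λ eq → ¬near (inj₂ (inj₂ (≡.sym eq))))
    l∈P : l ∈ P
    l∈P = P⁺ (λ eq → ¬near (inj₂ (inj₁ (≡.sym eq)))) (≢-sym i⁼≢l) (≢-sym (prev≢ l))
    |D|<k : ∣ image rep P ∣ < 3 + j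
    |D|<k = ℕ.≤-trans (s≤s (∣image∣≤ rep P)) (ℕ.≤-trans
      (Subset.x∈p⇒∣p-x∣<∣p∣ (Subset.x∈p∧x≢y⇒x∈p-y (Subset.x∈p∧x≢y⇒x∈p-y Subset.∈⊤ l⁻≢i⁻) l⁻≢i⁼))
      (ℕ.≤-pred (ℕ.≤-pred (2+∣⊤-x-y∣≤ (≢-sym (prev≢ i⁻))))))
    descend : ∀ κ → κ ∈ P → κ ≢ i → a (rep κ) (rep i) ≡ true ⊎ prev κ ∈ P
    descend κ κ∈P κ≢i with ∈p-x⁻ (⊤ - i⁻) (proj₁ (∈p-x⁻ (⊤ - i⁻ - i⁼) κ∈P))
    ... | κ∈ , _ = case κ ≟ l of λ where
      -- Below `l` the class is omitted; the new edge leads straight to `i`.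
      (yes refl) → inj₁ (addEdge⁺ (adj blowUp) (inj₂ (inj₂ (rep-l , rep-i))))
      (no κ≢l)   → inj₂ (P⁺ (κ≢i ∘ prev-injective) (proj₂ (∈p-x⁻ ⊤ κ∈) ∘ prev-injective)
                     (κ≢l ∘ prev-injective))
    near-P : ∀ κ → ∃[ κ′ ] κ′ ∈ P × Near κ κ′
    near-P κ with κ ≟ i⁻ | κ ≟ i⁼ | κ ≟ l⁻
    ... | yes refl | _        | _        = i , i∈P , inj₂ (inj₂ refl)
    -- `i⁼` is dominated from below; if it were `l`, its lower neighbour would be the omitted `l⁻`.
    ... | no _     | yes refl | _        =
          prev i⁼ , P⁺ (prev²≢ i⁻) (prev≢ i⁼) (i⁼≢l ∘ prev-injective) , inj₂ (inj₁ refl)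
    ... | no _     | no _     | yes refl = l , l∈P , inj₂ (inj₂ refl)
    ... | no ≢₁    | no ≢₂    | no ≢₃    = κ , P⁺ ≢₁ ≢₂ ≢₃ , inj₁ refl
    a-sym : ∀ x y → a x y ≡ true → a y x ≡ true
    a-sym x y xy = addEdge⁺ (adj blowUp) (case addEdge⁻ (adj blowUp) xy of λ where
      (inj₁ xy)                 → inj₁ (trans (sym blowUp y x) xy)
      (inj₂ (inj₁ (x≡u , y≡v))) → inj₂ (inj₂ (y≡v , x≡u))
      (inj₂ (inj₂ (x≡v , y≡u))) → inj₂ (inj₁ (y≡u , x≡v)))
    cds : IsCDS a (image rep P)
    cds = image-CDS a-sym (addEdge⁺ (adj blowUp) ∘ inj₁) i∈P descend near-P

  critical : Critical blowUp (3 + j)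
  critical = γc≡k , λ u v u≢v uv → case prev (prev (c u)) ≟ c v of λ where
      (no ≢l)  → γc<-addEdge u v u≢v uv ≢l
      -- When `v` lies two classes below `u`, exchange the two: the same obstruction again would
      -- make four steps down the identity.
      (yes ≡l) → case γc<-addEdge v u (≢-sym u≢v) (trans (sym blowUp v u) uv)
          (λ eq → prev⁴≢ (c u) (trans (cong (prev ∘ prev) ≡l) eq)) of λ where
        (D , cds , |D|<k) → D , IsCDS-mono
          (λ {x} {y} → addEdge⁺ (adj blowUp) {u} {v} {x} {y} ∘ swapped ∘ addEdge⁻ (adj blowUp))
          cds , |D|<k
    where
    swapped : ∀ {A B C : Set} → A ⊎ B ⊎ C → A ⊎ C ⊎ B
    swapped (inj₁ x)        = inj₁ x
    swapped (inj₂ (inj₁ x)) = inj₂ (inj₂ x)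
    swapped (inj₂ (inj₂ x)) = inj₂ (inj₁ x)

-- The counterexample for each k at least 3.

3≤∣p∣ : ∀ {n} {p : Subset n} {x y z} → x ∈ p → y ∈ p → z ∈ p → x ≢ y → x ≢ z → y ≢ z → 3 ≤ ∣ p ∣
3≤∣p∣ {p = p} {x} {y} x∈ y∈ z∈ x≢y x≢z y≢z =
  ℕ.≤-trans (s≤s (ℕ.≤-trans (s≤s (x∈p⇒1≤∣p∣ z∈p-x-y)) (Subset.x∈p⇒∣p-x∣<∣p∣ y∈p-x))) (Subset.x∈p⇒∣p-x∣<∣p∣ x∈)
  where
  y∈p-x : y ∈ p - x
  y∈p-x = Subset.x∈p∧x≢y⇒x∈p-y y∈ (≢-sym x≢y)
  z∈p-x-y : _ ∈ p - x - y
  z∈p-x-y = Subset.x∈p∧x≢y⇒x∈p-y (Subset.x∈p∧x≢y⇒x∈p-y z∈ (≢-sym x≢z)) (≢-sym y≢z)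

three-neighbours : ∀ {n} (G : Graph n) v x y z →
  adj G v x ≡ true → adj G v y ≡ true → adj G v z ≡ true →
  x ≢ y → x ≢ z → y ≢ z → 3 ≤ degree G v
three-neighbours G v x y z vx vy vz = 3≤∣p∣ (∈-tabulate⁺ _ vx) (∈-tabulate⁺ _ vy) (∈-tabulate⁺ _ vz)

-- `Fin (t * 2)` is read as `t` consecutive pairs, the classes of size 2: `half` gives the pair,
-- `double` its first element, `twin` the other element.
half : ∀ t → Fin (t * 2) → Fin t
half (suc t) zero          = zero
half (suc t) (suc zero)    = zero
half (suc t) (suc (suc x)) = suc (half t x)

double : ∀ t → Fin t → Fin (t * 2)
double (suc t) zero    = zero
double (suc t) (suc q) = suc (suc (double t q))

twin : ∀ t → Fin (t * 2) → Fin (t * 2)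
twin (suc t) zero          = suc zero
twin (suc t) (suc zero)    = zero
twin (suc t) (suc (suc x)) = suc (suc (twin t x))

half-double : ∀ t q → half t (double t q) ≡ q
half-double (suc t) zero    = refl
half-double (suc t) (suc q) = cong suc (half-double t q)

half-twin : ∀ t x → half t (twin t x) ≡ half t x
half-twin (suc t) zero          = refl
half-twin (suc t) (suc zero)    = refl
half-twin (suc t) (suc (suc x)) = cong suc (half-twin t x)

twin≢ : ∀ t x → twin t x ≢ x
twin≢ (suc t) zero          ()
twin≢ (suc t) (suc zero)    ()
twin≢ (suc t) (suc (suc x)) eq = twin≢ t x (Fin.suc-injective (Fin.suc-injective eq))

-- The blow-up of C_(5+j) with class sizes 1, 3, 1, 3, 2, …, 2. Deleting the
-- singleton classes (vertices 0 and 4) isolates the triangle {1, 2, 3}.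
module Example (j : ℕ) where

  -- The second class is odd, and not a single vertex, which would have degree 2 between singletons.
  -- The fourth is odd to make the first four total 8. The other `j + 1` classes are pairs,
  -- preserving parity and giving enough neighbours.
  order : ℕ
  order = 8 + suc j * 2

  pattern v₀ = zero
  pattern v₁ = suc zero
  pattern v₂ = suc v₁
  pattern v₃ = suc v₂
  pattern v₄ = suc v₃
  pattern v₅ = suc v₄
  pattern v₆ = suc v₅
  pattern v₇ = suc v₆
  pattern 4+ x = suc (suc (suc (suc x)))
  pattern 8+ x = 4+ (4+ x)

  class : Fin order → Fin (5 + j)
  class v₀     = v₀
  class v₁     = v₁
  class v₂     = v₁
  class v₃     = v₁
  class v₄     = v₂
  class v₅     = v₃
  class v₆     = v₃
  class v₇     = v₃
  class (8+ x) = 4+ (half (suc j) x)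

  member : Fin (5 + j) → Fin order
  member v₀     = v₀
  member v₁     = v₁
  member v₂     = v₄
  member v₃     = v₅
  member (4+ q) = 8+ (double (suc j) q)

  class-member : ∀ κ → class (member κ) ≡ κ
  class-member v₀     = refl
  class-member v₁     = refl
  class-member v₂     = refl
  class-member v₃     = refl
  class-member (4+ q) = cong (λ q → 4+ q) (half-double (suc j) q)

  open CycleBlowUp {j} class member class-member public

  minDegree : MinDegreeAtLeast blowUp 3
  minDegree v₀ = three-neighbours blowUp v₀ v₁ v₂ v₃ refl refl refl (λ ()) (λ ()) (λ ())
  minDegree v₁ = three-neighbours blowUp v₁ v₀ v₂ v₃ refl refl refl (λ ()) (λ ()) (λ ())
  minDegree v₂ = three-neighbours blowUp v₂ v₀ v₁ v₃ refl refl refl (λ ()) (λ ()) (λ ())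
  minDegree v₃ = three-neighbours blowUp v₃ v₀ v₁ v₂ refl refl refl (λ ()) (λ ()) (λ ())
  minDegree v₄ = three-neighbours blowUp v₄ v₁ v₂ v₃ refl refl refl (λ ()) (λ ()) (λ ())
  minDegree v₅ = three-neighbours blowUp v₅ v₄ v₆ v₇ refl refl refl (λ ()) (λ ()) (λ ())
  minDegree v₆ = three-neighbours blowUp v₆ v₄ v₅ v₇ refl refl refl (λ ()) (λ ()) (λ ())
  minDegree v₇ = three-neighbours blowUp v₇ v₄ v₅ v₆ refl refl refl (λ ()) (λ ()) (λ ())
  minDegree (8+ v₀) = three-neighbours blowUp (8+ v₀) v₅ v₆ v₇ refl refl refl (λ ()) (λ ()) (λ ())
  minDegree (8+ v₁) = three-neighbours blowUp (8+ v₁) v₅ v₆ v₇ refl refl refl (λ ()) (λ ()) (λ ())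
  -- From the second pair on, the three neighbours are both vertices of the preceding pair and the
  -- twin.
  minDegree (8+ (suc (suc x))) = three-neighbours blowUp (8+ x″) (8+ y) (8+ y′) (8+ x‴)
      (adj⁺ {8+ x″} {8+ y} (≢-sym (apart y x″ half-y refl)) (inj₂ (inj₁ (cong (λ q → 4+ q) (≡.sym half-y)))))
      (adj⁺ {8+ x″} {8+ y′} (≢-sym (apart y′ x″ half-y′ refl)) (inj₂ (inj₁ (cong (λ q → 4+ q) (≡.sym half-y′)))))
      (adj⁺ {8+ x″} {8+ x‴} (≢-sym (twin≢ t x″) ∘ 8+-injective) (inj₁ (cong (λ q → 4+ q) (≡.sym (half-twin t x″)))))
      (≢-sym (twin≢ t y) ∘ 8+-injective)
      (apart y x‴ half-y (half-twin t x″))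
      (apart y′ x‴ half-y′ (half-twin t x″))
    where
    t = suc j
    x″ x‴ y y′ : Fin (t * 2)
    x″ = suc (suc x)
    x‴ = twin t x″
    y  = double t (inject₁ (half j x))
    y′ = twin t y
    half-y : half t y ≡ inject₁ (half j x)
    half-y = half-double t _
    half-y′ : half t y′ ≡ inject₁ (half j x)
    half-y′ = trans (half-twin t y) half-y
    8+-injective : ∀ {m} {x y : Fin m} → _≡_ {A = Fin (8 + m)} (8+ x) (8+ y) → x ≡ y
    8+-injective refl = refl
    apart : ∀ {q} w z → half t w ≡ inject₁ q → half t z ≡ suc q → _≢_ {A = Fin order} (8+ w) (8+ z)
    apart {q} w z w↦ z↦ refl = ℕ.1+n≢n (trans (cong toℕ (trans (≡.sym z↦) w↦)) (Fin.toℕ-inject₁ q))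

  N[v₁] : ∀ y → adj blowUp v₁ y ≡ true → y ≢ v₀ → y ≢ v₄ → y ≡ v₂ ⊎ y ≡ v₃
  N[v₁] v₀ _ ≢₀ _ = contradiction refl ≢₀
  N[v₁] v₂ _ _ _  = inj₁ refl
  N[v₁] v₃ _ _ _  = inj₂ refl
  N[v₁] v₄ _ _ ≢₄ = contradiction refl ≢₄
  N[v₁] v₅ ()
  N[v₁] v₆ ()
  N[v₁] v₇ ()
  N[v₁] (8+ _) ()

  N[v₂] : ∀ y → adj blowUp v₂ y ≡ true → y ≢ v₀ → y ≢ v₄ → y ≡ v₁ ⊎ y ≡ v₃
  N[v₂] v₀ _ ≢₀ _ = contradiction refl ≢₀
  N[v₂] v₁ _ _ _  = inj₁ refl
  N[v₂] v₃ _ _ _  = inj₂ refl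
  N[v₂] v₄ _ _ ≢₄ = contradiction refl ≢₄
  N[v₂] v₅ ()
  N[v₂] v₆ ()
  N[v₂] v₇ ()
  N[v₂] (8+ _) ()

  N[v₃] : ∀ y → adj blowUp v₃ y ≡ true → y ≢ v₀ → y ≢ v₄ → y ≡ v₁ ⊎ y ≡ v₂
  N[v₃] v₀ _ ≢₀ _ = contradiction refl ≢₀
  N[v₃] v₁ _ _ _  = inj₁ refl
  N[v₃] v₂ _ _ _  = inj₂ refl
  N[v₃] v₄ _ _ ≢₄ = contradiction refl ≢₄
  N[v₃] v₅ ()
  N[v₃] v₆ ()
  N[v₃] v₇ ()
  N[v₃] (8+ _) ()

  ¬biCritical : ¬ BiCritical blowUp
  ¬biCritical bi with bi v₀ v₄ (λ ())
  ... | m , m-ok with m-ok v₁ (∈-without2 v₀ v₄ (λ ()) (λ ()))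
                    | m-ok v₂ (∈-without2 v₀ v₄ (λ ()) (λ ()))
                    | m-ok v₃ (∈-without2 v₀ v₄ (λ ()) (λ ()))
  ...   | m₁∈ , v₁m₁ , mm₁ | m₂∈ , v₂m₂ , mm₂ | m₃∈ , v₃m₃ , mm₃
    with N[v₁] _ v₁m₁ (proj₁ (without2-∉ v₀ v₄ m₁∈)) (proj₂ (without2-∉ v₀ v₄ m₁∈))
       | N[v₂] _ v₂m₂ (proj₁ (without2-∉ v₀ v₄ m₂∈)) (proj₂ (without2-∉ v₀ v₄ m₂∈))
       | N[v₃] _ v₃m₃ (proj₁ (without2-∉ v₀ v₄ m₃∈)) (proj₂ (without2-∉ v₀ v₄ m₃∈))
  -- The partner map would be a fixed-point-free involution of the triangle: once `v₁` has a
  -- partner, the third vertex has none left.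
  ... | inj₁ m₁≡v₂ | _          | inj₁ m₃≡v₁ =
    case trans (≡.sym m₁≡v₂) (trans (cong m (≡.sym m₃≡v₁)) mm₃) of λ ()
  ... | inj₁ m₁≡v₂ | _          | inj₂ m₃≡v₂ =
    case trans (≡.sym mm₁) (trans (cong m (trans m₁≡v₂ (≡.sym m₃≡v₂))) mm₃) of λ ()
  ... | inj₂ m₁≡v₃ | inj₁ m₂≡v₁ | _          =
    case trans (≡.sym m₁≡v₃) (trans (cong m (≡.sym m₂≡v₁)) mm₂) of λ ()
  ... | inj₂ m₁≡v₃ | inj₂ m₂≡v₃ | _          =
    case trans (≡.sym mm₁) (trans (cong m (trans m₁≡v₃ (≡.sym m₂≡v₃))) mm₂) of λ ()

theorem5 : (k : ℕ) → 1 ≤ k →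
    ((∀ (n : ℕ) (G : Graph n) → Critical G k → ClawFree G → 2 ∣ n →
    MinDegreeAtLeast G 3 → BiCritical G)
    ⇔ (k ≡ 1 ⊎ k ≡ 2))
theorem5 k 1≤k = mk⇔ (to k 1≤k)
  λ k∈ n G crit _ 2∣n δ → coStarForest-biCritical G (critical⇒coStarForest G k∈ crit) 2∣n δ
  where
  to : ∀ k → 1 ≤ k → (∀ n (G : Graph n) → Critical G k → ClawFree G → 2 ∣ n →
    MinDegreeAtLeast G 3 → BiCritical G) → k ≡ 1 ⊎ k ≡ 2
  to 1                   _ _   = inj₁ refl
  to 2                   _ _   = inj₂ refl
  to (suc (suc (suc j))) _ all = contradiction
    (all order blowUp critical clawFree (divides (4 + suc j) refl) minDegree) ¬biCritical
    where open Example j
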